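{- If $\sigma$ is an unrestrictive permutation then $F_n(123,\sigma)=F_n(123)$ for all $n\ge 0$. In particular, $|F_n(123,\sigma)|=2^{n-1}$ for all $n\ge 1$.
   Context: A permutation contains a pattern $\sigma$ if some subsequence of it has the same length and relative order as $\sigma$; otherwise it avoids $\sigma$. A copy of the Fishburn pattern $f$ in a permutation $\pi$ (in one-line notation) is a subsequence $\pi_j,\pi_{j+1},\pi_k$ with $j+1<k$, $\pi_j=\pi_k+1$, and $\pi_{j+1}>\pi_j$; a Fishburn permutation is one with no copy of $f$. $F_n(\sigma_1,\dots,\sigma_m)$ is the set of Fishburn permutations of length $n$ avoiding each $\sigma_i$. A permutation $\sigma$ is unrestrictive if $\sigma$ avoids $123$, $\sigma$ contains $f$, and $\sigma$ contains at least one of $2413$ and $3412$. -}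

module Defs where

open import Data.Fin.Base using (Fin; toℕ; _<_)
open import Data.Fin.Patterns using (0F; 1F; 2F; 3F)
open import Data.Fin.Permutation using (Permutation′; permutation; _⟨$⟩ʳ_)
import Data.Fin.Permutation as Perm
open import Data.Fin.Properties using (all?; _≟_)
open import Data.List.Base using (List)
open import Data.List.Relation.Unary.All using (All)
open import Data.Nat.Base using (ℕ; suc)
open import Data.Product.Base using (∃; _×_; _,_; proj₁)
open import Data.Sum.Base using (_⊎_)
open import Data.Vec.Base using (Vec; []; _∷_; lookup)
open import Function.Bundles using (_⇔_; Inverse)
open import Level using (0ℓ)
open import Relation.Binary.Bundles using (Setoid)
import Relation.Binary.Construct.On as On
open import Relation.Binary.Core using (_Preserves_⟶_)
open import Relation.Binary.PropositionalEquality.Core using (_≡_; refl; sym; trans)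
import Relation.Binary.PropositionalEquality.Properties as ≡
open import Relation.Nullary.Decidable using (True; toWitness)
open import Relation.Nullary.Negation using (¬_)
open import Relation.Unary using (Pred)

-- A permutation π of length n is a bijection of Fin n, so positions and
-- values both run over 0, …, n - 1; the entry π_i is π ⟨$⟩ʳ i.

-- The permutation with one-line notation w, given with the one-line
-- notation of its inverse.
oneLine : ∀ {n} (w w⁻¹ : Vec (Fin n) n) →
          {True (all? λ i → lookup w (lookup w⁻¹ i) ≟ i)} →
          {True (all? λ i → lookup w⁻¹ (lookup w i) ≟ i)} →
          Permutation′ n
oneLine w w⁻¹ {l} {r} =
  permutation (lookup w) (lookup w⁻¹) (toWitness l) (toWitness r)

-- In one-line notation, with each entry lowered by one.
p123 : Permutation′ 3
p123 = oneLine (0F ∷ 1F ∷ 2F ∷ []) (0F ∷ 1F ∷ 2F ∷ [])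

p2413 p3412 : Permutation′ 4
p2413 = oneLine (1F ∷ 3F ∷ 0F ∷ 2F ∷ []) (2F ∷ 0F ∷ 3F ∷ 1F ∷ [])
p3412 = oneLine (2F ∷ 3F ∷ 0F ∷ 1F ∷ []) (2F ∷ 3F ∷ 0F ∷ 1F ∷ [])

infix 4 _Contains_ _Avoids_

-- The subsequence is given by its increasing sequence ι of positions.
_Contains_ : ∀ {n k} → Permutation′ n → Permutation′ k → Set
_Contains_ {n} {k} π σ = ∃ λ (ι : Fin k → Fin n) →
  (ι Preserves _<_ ⟶ _<_) ×
  (∀ a b → (σ ⟨$⟩ʳ a < σ ⟨$⟩ʳ b) ⇔ (π ⟨$⟩ʳ ι a < π ⟨$⟩ʳ ι b))

_Avoids_ : ∀ {n k} → Permutation′ n → Permutation′ k → Set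
π Avoids σ = ¬ (π Contains σ)

-- j′ is the position j + 1.
ContainsFishburn : ∀ {n} → Permutation′ n → Set
ContainsFishburn {n} π = ∃ λ (j : Fin n) → ∃ λ (j′ : Fin n) → ∃ λ (k : Fin n) →
  toℕ j′ ≡ suc (toℕ j) ×
  j′ < k ×
  toℕ (π ⟨$⟩ʳ j) ≡ suc (toℕ (π ⟨$⟩ʳ k)) ×
  π ⟨$⟩ʳ j < π ⟨$⟩ʳ j′

IsFishburn : ∀ {n} → Permutation′ n → Set
IsFishburn π = ¬ ContainsFishburn π

F : (n : ℕ) → List (∃ Permutation′) → Pred (Permutation′ n) 0ℓ
F n σs π = IsFishburn π × All (λ (_ , σ) → π Avoids σ) σs

Unrestrictive : ∀ {k} → Permutation′ k → Set
Unrestrictive σ =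
  σ Avoids p123 × ContainsFishburn σ × (σ Contains p2413 ⊎ σ Contains p3412)

permutationSetoid : ℕ → Setoid 0ℓ 0ℓ
permutationSetoid n = record
  { Carrier       = Permutation′ n
  ; _≈_           = Perm._≈_
  ; isEquivalence = record
    { refl  = λ _ → refl
    ; sym   = λ p i → sym (p i)
    ; trans = λ p q i → trans (p i) (q i)
    }
  }

-- Members of P are identified when they agree pointwise, whatever their
-- proofs of membership.
subsetoid : ∀ {n} → Pred (Permutation′ n) 0ℓ → Setoid 0ℓ 0ℓ
subsetoid {n} P = On.setoid {B = ∃ P} (permutationSetoid n) proj₁

HasCardinality : ∀ {n} → Pred (Permutation′ n) 0ℓ → ℕ → Set
HasCardinality P N = Inverse (subsetoid P) (≡.setoid (Fin N))

{-# OPTIONS --safe #-}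

-- If π is Fishburn and avoids 123, then every ascent π_j < π_{j+1} has π_j = 0:
-- otherwise the value π_j - 1 stands to the left of j, giving a copy of 123, or
-- to the right of j + 1, giving a copy of f. So π decreases down to 0 and then
-- decreases again; it never has two ascents in succession, and hence avoids
-- 2413 and 3412, and with them σ. Conversely any set of nonzero values may be
-- placed to the right of 0, and π is determined by that set.

module Submission where

open import Defs
open import Data.Fin.Base
  using (Fin; zero; suc; toℕ; _<_; inject₁; combine; opposite; punchIn; finToFun; funToFin)
  renaming (_≤_ to _≤ᶠ_)
open import Data.Fin.Patterns using (0F; 1F; 2F; 3F)
open import Data.Fin.Permutation
  using (Permutation′; _⟨$⟩ʳ_; _⟨$⟩ˡ_; inverseˡ; inverseʳ; insert; insert-punchIn)
import Data.Fin.Permutation as Perm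
open import Data.Fin.Properties as Fin
  using (<-cmp; _<?_; toℕ-injective; toℕ-inject₁; toℕ-combine; toℕ<n; combine-monoˡ-<;
         combine-injectiveʳ; opposite-prop; opposite-involutive; punchIn-injective; punchInᵢ≢i;
         finToFun-funToFin; funToFin-finToFin)
open import Data.List.Base using ([]; _∷_; allFin)
open import Data.List.Membership.Propositional.Properties using (∈-allFin)
open import Data.List.Relation.Unary.All as All using ([]; _∷_)
open import Data.Nat.Base using (ℕ; zero; suc; _≤_; _∸_; _^_; z≤n; s≤s; z<s; s<s)
import Data.Nat.Base as ℕ
import Data.Nat.Properties as ℕ
open import Data.List.Extrema ℕ.≤-totalOrder using (argmin; f[argmin]≤f[xs])
open import Data.Product.Base using (∃; _×_; _,_; proj₁; proj₂)
open import Data.Sum.Base using (inj₁; inj₂; [_,_]′)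
open import Data.Vec.Base using ([]; _∷_; lookup)
import Data.Vec.Functional as Vector
open import Function.Base using (_∘_)
open import Function.Bundles using (Equivalence; Inverse; mk⇔)
open import Function.Construct.Composition using (_⇔-∘_)
open import Function.Definitions using (Injective)
open import Relation.Binary.Core using (_Preserves_⟶_)
open import Relation.Binary.Definitions using (Tri; tri<; tri≈; tri>)
open import Relation.Binary.PropositionalEquality
  using (_≡_; _≢_; _≗_; refl; sym; trans; cong; cong₂; subst; subst₂)
open import Relation.Nullary using (¬_; yes; no; contradiction)
open import Relation.Unary using (Pred; _≐_)
open import Relation.Unary.Properties using (≐-sym)
open import Level using (0ℓ)

private variable
  l m n o N : ℕ

-- Strictly increasing maps between finite ordinals

-- Reduces sortedness to adjacent positions, where the Fishburn condition says something about
-- ascents.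
stepwise⇒monotone : (f : Fin n → Fin N) →
  (∀ i j → toℕ j ≡ suc (toℕ i) → f i < f j) → f Preserves _<_ ⟶ _<_
stepwise⇒monotone f step {zero}  {suc zero}    _ = step 0F 1F refl
stepwise⇒monotone f step {zero}  {suc (suc j)} _ = ℕ.<-trans (step 0F 1F refl)
  (stepwise⇒monotone (f ∘ suc) (λ i j eq → step (suc i) (suc j) (cong suc eq)) {zero} {suc j} z<s)
stepwise⇒monotone f step {suc i} {suc j} (s<s i<j) =
  stepwise⇒monotone (f ∘ suc) (λ i j eq → step (suc i) (suc j) (cong suc eq)) i<j

-- Each step gains at least one; restricting along `inject₁` makes the predecessor of `suc i`
-- available to the induction.
monotone⇒inflationary : (f : Fin m → Fin n) → f Preserves _<_ ⟶ _<_ →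
  ∀ i → toℕ i ℕ.≤ toℕ (f i)
monotone⇒inflationary f mono zero    = z≤n
monotone⇒inflationary {m = suc (suc _)} f mono (suc i) = ℕ.≤-<-trans
  (monotone⇒inflationary (f ∘ inject₁) (mono ∘ subst₂ ℕ._<_ (sym (toℕ-inject₁ _)) (sym (toℕ-inject₁ _))) i)
  (mono (s≤s (ℕ.≤-reflexive (toℕ-inject₁ i))))

monotone⇒reflects-< : (f : Fin m → Fin n) → f Preserves _<_ ⟶ _<_ → ∀ {i j} → f i < f j → i < j
monotone⇒reflects-< f mono {i} {j} fi<fj with <-cmp i j
... | tri< i<j _ _  = i<j
... | tri≈ _ refl _ = contradiction fi<fj (ℕ.<-irrefl refl)
... | tri> _ _ j<i  = contradiction fi<fj (ℕ.<-asym (mono j<i))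

-- Permutations that sort a key

_Sorts_ : Permutation′ n → (Fin n → Fin N) → Set
π Sorts f = (λ i → f (π ⟨$⟩ʳ i)) Preserves _<_ ⟶ _<_

module _ (f : Fin n → Fin N) where

  sorts⇒position-< : (π : Permutation′ n) → π Sorts f →
    ∀ {u v} → f u < f v → π ⟨$⟩ˡ u < π ⟨$⟩ˡ v
  sorts⇒position-< π sorts = monotone⇒reflects-< (λ i → f (π ⟨$⟩ʳ i)) sorts ∘
    subst₂ (λ u v → f u < f v) (sym (inverseʳ π)) (sym (inverseʳ π))

  -- Both ρ⁻¹π and π⁻¹ρ are strictly increasing, hence inflationary. As they are mutually inverse, i
  -- ≤ ρ⁻¹π(i) ≤ π⁻¹ρ(ρ⁻¹π(i)) = i.
  sorts-unique : (π ρ : Permutation′ n) → π Sorts f → ρ Sorts f → π Perm.≈ ρ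
  sorts-unique π ρ π-sorts ρ-sorts i =
    trans (sym (inverseʳ ρ)) (cong (ρ ⟨$⟩ʳ_) (toℕ-injective (ℕ.≤-antisym
      (subst (λ j → toℕ (ρ ⟨$⟩ˡ (π ⟨$⟩ʳ i)) ℕ.≤ toℕ j)
        (trans (cong (π ⟨$⟩ˡ_) (inverseʳ ρ)) (inverseˡ π))
        (monotone⇒inflationary (λ j → π ⟨$⟩ˡ (ρ ⟨$⟩ʳ j)) (sorts⇒position-< π π-sorts ∘ ρ-sorts) _))
      (monotone⇒inflationary (λ j → ρ ⟨$⟩ˡ (π ⟨$⟩ʳ j)) (sorts⇒position-< ρ ρ-sorts ∘ π-sorts) i))))

argmin-minimal : (f : Fin (suc n) → Fin N) → ∀ v → f (argmin (toℕ ∘ f) 0F (allFin _)) ≤ᶠ f v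
argmin-minimal f v = All.lookup (f[argmin]≤f[xs] {f = toℕ ∘ f} 0F (allFin _)) (∈-allFin v)

-- Selection sort: a value minimizing `f` goes to position 0, and the others, enumerated by
-- `punchIn v`, are sorted recursively.
sorting-exists : (f : Fin n → Fin N) → Injective _≡_ _≡_ f → ∃ λ (π : Permutation′ n) → π Sorts f
sorting-exists {zero}  f inj = Perm.id , λ { {()} }
sorting-exists {suc n} f inj = insert 0F v π , sorts
  where
  v = argmin (toℕ ∘ f) 0F (allFin _)
  rest = sorting-exists (f ∘ punchIn v) (punchIn-injective v _ _ ∘ inj)
  π = proj₁ rest
  sorts : insert 0F v π Sorts f
  sorts {zero}  {suc j} _ = subst (λ w → f v < f w) (sym (insert-punchIn 0F v π j))
    (Fin.≤∧≢⇒< (argmin-minimal f _) (punchInᵢ≢i v _ ∘ sym ∘ inj))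
  sorts {suc i} {suc j} (s<s i<j) = subst₂ (λ u w → f u < f w)
    (sym (insert-punchIn 0F v π i)) (sym (insert-punchIn 0F v π j)) (proj₂ rest i<j)

-- Two decreasing blocks

-- s v is the block (0F or 1F) containing the value v; sorting by key s puts
-- block 0F before block 1F and the values of each block in decreasing order.
key : (Fin n → Fin 2) → Fin n → Fin (2 ℕ.* n)
key s v = combine (s v) (opposite v)

opposite-injective : {u v : Fin n} → opposite u ≡ opposite v → u ≡ v
opposite-injective eq =
  trans (sym (opposite-involutive _)) (trans (cong opposite eq) (opposite-involutive _))

opposite-anti-< : {u v : Fin n} → v < u → opposite u < opposite v
opposite-anti-< {u = u} {v} v<u = subst₂ ℕ._<_ (sym (opposite-prop u)) (sym (opposite-prop v))
  (ℕ.∸-monoʳ-< (s<s v<u) (toℕ<n u))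

key-injective : (s : Fin n → Fin 2) → Injective _≡_ _≡_ (key s)
key-injective s {u} {v} eq =
  opposite-injective (combine-injectiveʳ (s u) (opposite u) (s v) (opposite v) eq)

key-cong : {s t : Fin n → Fin 2} → s ≗ t → key s ≗ key t
key-cong s≗t v = cong (λ b → combine b (opposite v)) (s≗t v)

module _ (s : Fin n → Fin 2) {u v : Fin n} where

  key-<⇒block-≤ : key s u < key s v → s u ≤ᶠ s v
  key-<⇒block-≤ lt = ℕ.≮⇒≥ λ gt →
    ℕ.<-asym lt (combine-monoˡ-< (opposite v) (opposite u) gt)

  block-≤∧>⇒key-< : s u ≤ᶠ s v → v < u → key s u < key s v
  block-≤∧>⇒key-< su≤sv v<u with <-cmp (s u) (s v)
  ... | tri< lt _ _ = combine-monoˡ-< (opposite u) (opposite v) lt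
  ... | tri> _ _ gt = contradiction su≤sv (ℕ.<⇒≱ gt)
  -- In a common block the keys n · block + `opposite` differ only in the last summand.
  ... | tri≈ _ eq _ rewrite toℕ-combine (s u) (opposite u) | toℕ-combine (s v) (opposite v) | eq =
        ℕ.+-monoʳ-< (n ℕ.* toℕ (s v)) (opposite-anti-< v<u)

module _ (s : Fin n → Fin 2) (π : Permutation′ n) (sorts : π Sorts key s) where

  private
    block : Fin n → Fin 2
    block i = s (π ⟨$⟩ʳ i)

  block-monotone : ∀ {i j} → i ≤ᶠ j → block i ≤ᶠ block j
  block-monotone {i} {j} i≤j with <-cmp i j
  ... | tri< i<j _ _  = key-<⇒block-≤ s (sorts i<j)
  ... | tri≈ _ refl _ = ℕ.≤-refl
  ... | tri> _ _ j<i  = contradiction i≤j (ℕ.<⇒≱ j<i)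

  -- Values decrease within a block, so an ascent has to cross into a later one.
  ascent⇒block-< : ∀ {i j} → i < j → π ⟨$⟩ʳ i < π ⟨$⟩ʳ j → block i < block j
  ascent⇒block-< i<j πi<πj = ℕ.≰⇒> λ ge →
    ℕ.<-asym (sorts i<j) (block-≤∧>⇒key-< s ge πi<πj)

  -- Each ascent raises the block, so two in succession would need a third block.
  no-two-ascents : ∀ {a b c d} → a < b → b ≤ᶠ c → c < d →
    π ⟨$⟩ʳ a < π ⟨$⟩ʳ b → ¬ π ⟨$⟩ʳ c < π ⟨$⟩ʳ d
  no-two-ascents {d = d} a<b b≤c c<d πa<πb πc<πd = ℕ.<⇒≱
    (ℕ.≤-<-trans (ℕ.≤-trans (ℕ.≤-trans (s≤s z≤n) (ascent⇒block-< a<b πa<πb)) (block-monotone b≤c))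
      (ascent⇒block-< c<d πc<πd))
    (ℕ.s≤s⁻¹ (toℕ<n (block d)))

  sorts⇒avoids-123 : π Avoids p123
  sorts⇒avoids-123 (ι , mono , iso) =
    no-two-ascents (mono {0F} {1F} z<s) ℕ.≤-refl (mono {1F} {2F} (s<s z<s))
      (Equivalence.to (iso 0F 1F) z<s) (Equivalence.to (iso 1F 2F) (s<s z<s))

  sorts⇒avoids-2413 : π Avoids p2413
  sorts⇒avoids-2413 (ι , mono , iso) =
    -- The two ascents are 24 and 13.
    no-two-ascents (mono {0F} {1F} z<s) (ℕ.<⇒≤ (mono {1F} {2F} (s<s z<s))) (mono {2F} {3F} (s<s (s<s z<s)))
      (Equivalence.to (iso 0F 1F) (s<s z<s)) (Equivalence.to (iso 2F 3F) z<s)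

  sorts⇒avoids-3412 : π Avoids p3412
  sorts⇒avoids-3412 (ι , mono , iso) =
    no-two-ascents (mono {0F} {1F} z<s) (ℕ.<⇒≤ (mono {1F} {2F} (s<s z<s))) (mono {2F} {3F} (s<s (s<s z<s)))
      (Equivalence.to (iso 0F 1F) (s<s (s<s z<s))) (Equivalence.to (iso 2F 3F) z<s)

-- Constructing copies of 123

p123-identity : ∀ i → p123 ⟨$⟩ʳ i ≡ i
p123-identity 0F = refl
p123-identity 1F = refl
p123-identity 2F = refl

lookup-monotone : {a b c : Fin n} → a < b → b < c → lookup (a ∷ b ∷ c ∷ []) Preserves _<_ ⟶ _<_
lookup-monotone {a = a} {b} {c} a<b b<c = stepwise⇒monotone (lookup (a ∷ b ∷ c ∷ [])) λ where
  0F 1F _ → a<b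
  1F 2F _ → b<c

module _ (π : Permutation′ n) where

  ascending⇒contains-123 : ∀ {a b c} → a < b → b < c →
    π ⟨$⟩ʳ a < π ⟨$⟩ʳ b → π ⟨$⟩ʳ b < π ⟨$⟩ʳ c → π Contains p123
  ascending⇒contains-123 {a} {b} {c} a<b b<c πa<πb πb<πc =
    ι , lookup-monotone a<b b<c , λ i j → mk⇔
      (πι-monotone ∘ subst₂ _<_ (p123-identity i) (p123-identity j))
      (subst₂ _<_ (sym (p123-identity i)) (sym (p123-identity j)) ∘ monotone⇒reflects-< πι πι-monotone)
    where
    ι πι : Fin 3 → Fin n
    ι  = lookup (a ∷ b ∷ c ∷ [])
    πι i = π ⟨$⟩ʳ ι i
    πι-monotone : πι Preserves _<_ ⟶ _<_
    πι-monotone = stepwise⇒monotone πι λ where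
      0F 1F _ → πa<πb
      1F 2F _ → πb<πc

-- The blocks to the left and right of 0

isAfter : Fin n → Fin n → Fin 2
isAfter i j with i <? j
... | yes _ = 1F
... | no  _ = 0F

-- The block function read off from `π`; the value 0 itself closes the left block.
side : Permutation′ (suc m) → Fin (suc m) → Fin 2
side π v = isAfter (π ⟨$⟩ˡ 0F) (π ⟨$⟩ˡ v)

module _ (π : Permutation′ (suc m)) where

  side-right : ∀ {v} → π ⟨$⟩ˡ 0F < π ⟨$⟩ˡ v → side π v ≡ 1F
  side-right {v} lt with π ⟨$⟩ˡ 0F <? π ⟨$⟩ˡ v
  ... | yes _ = refl
  ... | no ≮ = contradiction lt ≮

  side-left : ∀ {v} → π ⟨$⟩ˡ v ≤ᶠ π ⟨$⟩ˡ 0F → side π v ≡ 0F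
  side-left {v} ge with π ⟨$⟩ˡ 0F <? π ⟨$⟩ˡ v
  ... | yes lt = contradiction ge (ℕ.<⇒≱ lt)
  ... | no _ = refl

  side-cong : ∀ ρ → π Perm.≈ ρ → side π ≗ side ρ
  side-cong ρ π≈ρ v = cong₂ isAfter (π⁻¹≈ρ⁻¹ 0F) (π⁻¹≈ρ⁻¹ v)
    where
    π⁻¹≈ρ⁻¹ : ∀ w → π ⟨$⟩ˡ w ≡ ρ ⟨$⟩ˡ w
    π⁻¹≈ρ⁻¹ w = trans (sym (inverseˡ ρ)) (cong (ρ ⟨$⟩ˡ_) (trans (sym (π≈ρ _)) (inverseʳ π)))

  side-monotone : ∀ {u v} → π ⟨$⟩ˡ u ≤ᶠ π ⟨$⟩ˡ v → side π u ≤ᶠ side π v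
  side-monotone {u} {v} u≤v with π ⟨$⟩ˡ 0F <? π ⟨$⟩ˡ u
  ... | yes 0<u = ℕ.≤-reflexive (cong toℕ (sym (side-right (ℕ.<-≤-trans 0<u u≤v))))
  ... | no  _   = z≤n

  module _ (s : Fin (suc m) → Fin 2) (s0≡0 : s 0F ≡ 0F) (sorts : π Sorts key s) where

    -- As the least value, 0 comes last in block 0F: the rest of that block precedes it and block 1F
    -- follows it.
    sorts⇒side : side π ≗ s
    sorts⇒side zero = trans (side-left ℕ.≤-refl) (sym s0≡0)
    sorts⇒side (suc v) with s (suc v) in eq
    ... | 0F = side-left (ℕ.<⇒≤ (sorts⇒position-< (key s) π sorts (block-≤∧>⇒key-< s
                 (ℕ.≤-reflexive (cong toℕ (trans eq (sym s0≡0)))) z<s)))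
    ... | 1F = side-right (sorts⇒position-< (key s) π sorts (combine-monoˡ-< _ _
                 (subst₂ _<_ (sym s0≡0) (sym eq) z<s)))

    -- The ascent in a copy of f leads from block 0F to block 1F. Its bottom is nonzero, being one
    -- more than another value, so it stands before 0. Then position j + 1 is at most that of 0 and
    -- still lies in block 0F.
    sorts⇒Fishburn : IsFishburn π
    sorts⇒Fishburn (j , j′ , k , j′≡1+j , j′<k , πj≡1+πk , πj<πj′) =
      ℕ.<⇒≱ block-j′>0 (subst (λ w → s (π ⟨$⟩ʳ j′) ≤ᶠ w) (trans (cong s (inverseʳ π)) s0≡0)
        (block-monotone s π sorts j′≤z))
      where
      j<j′ : j < j′
      j<j′ = ℕ.≤-reflexive (sym j′≡1+j)
      block-j<j′ : s (π ⟨$⟩ʳ j) < s (π ⟨$⟩ʳ j′)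
      block-j<j′ = ascent⇒block-< s π sorts j<j′ πj<πj′
      block-j′>0 : 0 ℕ.< toℕ (s (π ⟨$⟩ʳ j′))
      block-j′>0 = ℕ.≤-<-trans z≤n block-j<j′
      block-j≤0 : s (π ⟨$⟩ʳ j) ≤ᶠ s 0F
      block-j≤0 = subst (s (π ⟨$⟩ʳ j) ≤ᶠ_) (sym s0≡0)
        (ℕ.s≤s⁻¹ (ℕ.<-≤-trans block-j<j′ (ℕ.s≤s⁻¹ (toℕ<n (s (π ⟨$⟩ʳ j′))))))
      j<z : j < π ⟨$⟩ˡ 0F
      j<z = subst (_< π ⟨$⟩ˡ 0F) (inverseˡ π) (sorts⇒position-< (key s) π sorts
        (block-≤∧>⇒key-< s block-j≤0 (subst (0 ℕ.<_) (sym πj≡1+πk) z<s)))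
      j′≤z : j′ ≤ᶠ π ⟨$⟩ˡ 0F
      j′≤z = subst (ℕ._≤ _) (sym j′≡1+j) j<z

  module _ (fishburn : IsFishburn π) (avoids : π Avoids p123) where

    ascent-bottom : ∀ i j → toℕ j ≡ suc (toℕ i) → π ⟨$⟩ʳ i < π ⟨$⟩ʳ j → π ⟨$⟩ʳ i ≡ 0F
    ascent-bottom i j j≡1+i πi<πj with π ⟨$⟩ʳ i in πi≡
    ... | zero  = refl
    ... | suc u = contradiction-at (<-cmp k i)
      where
      -- The position of the value one below `suc u`, the low entry of either forbidden copy.
      k = π ⟨$⟩ˡ inject₁ u
      i<j : i < j
      i<j = ℕ.≤-reflexive (sym j≡1+i)
      πi<πj′ : π ⟨$⟩ʳ i < π ⟨$⟩ʳ j
      πi<πj′ = subst (_< π ⟨$⟩ʳ j) (sym πi≡) πi<πj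
      πi≡1+πk : toℕ (π ⟨$⟩ʳ i) ≡ suc (toℕ (π ⟨$⟩ʳ k))
      πi≡1+πk = trans (cong toℕ πi≡) (cong suc (sym (trans (cong toℕ (inverseʳ π)) (toℕ-inject₁ u))))
      πk<πi : π ⟨$⟩ʳ k < π ⟨$⟩ʳ i
      πk<πi = ℕ.≤-reflexive (sym πi≡1+πk)
      -- Needed to strengthen i < k to j < k when j = i + 1.
      j≢k : j ≢ k
      j≢k j≡k = ℕ.<-asym πi<πj′ (subst (λ l → π ⟨$⟩ʳ l < π ⟨$⟩ʳ i) (sym j≡k) πk<πi)
      contradiction-at : Tri (k < i) (k ≡ i) (i < k) → suc u ≡ 0F
      contradiction-at (tri< k<i _ _) = contradiction
        (ascending⇒contains-123 π k<i i<j πk<πi πi<πj′) avoids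
      contradiction-at (tri≈ _ k≡i _) = contradiction πk<πi (ℕ.<-irrefl (cong (λ l → toℕ (π ⟨$⟩ʳ l)) k≡i))
      contradiction-at (tri> _ _ i<k) = contradiction
        (i , j , k , j≡1+i , Fin.≤∧≢⇒< (subst (ℕ._≤ toℕ k) (sym j≡1+i) i<k) j≢k , πi≡1+πk , πi<πj′)
        fishburn

    -- A descent never leads back to an earlier block, which suffices; an ascent starts at 0, the
    -- end of block 0F, and so enters block 1F.
    sorts-side : π Sorts key (side π)
    sorts-side = stepwise⇒monotone (λ i → key (side π) (π ⟨$⟩ʳ i)) step
      where
      step : ∀ i j → toℕ j ≡ suc (toℕ i) → key (side π) (π ⟨$⟩ʳ i) < key (side π) (π ⟨$⟩ʳ j)
      step i j j≡1+i with ℕ.≤-reflexive (sym j≡1+i) | <-cmp (π ⟨$⟩ʳ i) (π ⟨$⟩ʳ j)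
      ... | i<j | tri> _ _ πj<πi = block-≤∧>⇒key-< (side π)
            (side-monotone (subst₂ _≤ᶠ_ (sym (inverseˡ π)) (sym (inverseˡ π)) (ℕ.<⇒≤ i<j))) πj<πi
      ... | i<j | tri≈ _ πi≡πj _ = contradiction i<j (ℕ.<-irrefl (cong toℕ
            (trans (sym (inverseˡ π)) (trans (cong (π ⟨$⟩ˡ_) πi≡πj) (inverseˡ π)))))
      ... | i<j | tri< πi<πj _ _ = combine-monoˡ-< _ _ (subst₂ _<_
            (sym (side-left (ℕ.≤-reflexive (cong (toℕ ∘ (π ⟨$⟩ˡ_)) πi≡0))))
            (sym (side-right (subst₂ _<_ (trans (sym (inverseˡ π)) (cong (π ⟨$⟩ˡ_) πi≡0)) (sym (inverseˡ π)) i<j)))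
            z<s)
        where
        πi≡0 : π ⟨$⟩ʳ i ≡ 0F
        πi≡0 = ascent-bottom i j j≡1+i πi<πj

-- Unrestrictive patterns are avoided automatically

contains-trans : (π : Permutation′ l) (σ : Permutation′ m) (τ : Permutation′ n) →
  π Contains σ → σ Contains τ → π Contains τ
contains-trans π σ τ (ι , ι-mono , π≅σ) (κ , κ-mono , σ≅τ) =
  ι ∘ κ , ι-mono ∘ κ-mono , λ a b → π≅σ (κ a) (κ b) ⇔-∘ σ≅τ a b

F123 : (n : ℕ) → Pred (Permutation′ n) 0ℓ
F123 n = F n ((3 , p123) ∷ [])

F123⇒avoids-unrestrictive : (σ : Permutation′ o) → Unrestrictive σ →
  (π : Permutation′ n) → F123 n π → π Avoids σ
-- The empty permutation has no value 0 to split at; here `σ` is nonempty, as it contains a pattern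
-- of length 4.
F123⇒avoids-unrestrictive {n = zero} σ (_ , _ , inj₁ (κ , _)) π _ (ι , _) with () ← ι (κ 0F)
F123⇒avoids-unrestrictive {n = zero} σ (_ , _ , inj₂ (κ , _)) π _ (ι , _) with () ← ι (κ 0F)
F123⇒avoids-unrestrictive {n = suc m} σ (_ , _ , σ-contains) π (fishburn , avoids ∷ []) π-contains-σ =
  [ sorts⇒avoids-2413 (side π) π sorts ∘ contains-trans π σ p2413 π-contains-σ
  , sorts⇒avoids-3412 (side π) π sorts ∘ contains-trans π σ p3412 π-contains-σ
  ]′ σ-contains
  where
  sorts = sorts-side π fishburn avoids

-- Counting by binary words

module _ (m : ℕ) where

  private
    -- The m binary digits of `x` place the nonzero values; 0 is fixed in block 0F.
    blocks : Fin (2 ^ m) → Fin (suc m) → Fin 2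
    blocks x = 0F Vector.∷ finToFun x

    sorting : ∀ x → ∃ λ (π : Permutation′ (suc m)) → π Sorts key (blocks x)
    sorting x = sorting-exists (key (blocks x)) (key-injective (blocks x))

    encode : Permutation′ (suc m) → Fin (2 ^ m)
    encode π = funToFin (side π ∘ suc)

    funToFin-cong : {f g : Fin n → Fin o} → f ≗ g → funToFin f ≡ funToFin g
    funToFin-cong {n = zero}  f≗g = refl
    funToFin-cong {n = suc _} f≗g = cong₂ combine (f≗g 0F) (funToFin-cong (f≗g ∘ suc))

    sorts-encode : ∀ π → F123 (suc m) π → π Sorts key (blocks (encode π))
    sorts-encode π (fishburn , avoids ∷ []) {i} {j} i<j =
      subst₂ _<_ (key-cong side≗blocks (π ⟨$⟩ʳ i)) (key-cong side≗blocks (π ⟨$⟩ʳ j))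
        (sorts-side π fishburn avoids i<j)
      where
      side≗blocks : side π ≗ blocks (encode π)
      side≗blocks zero    = side-left π ℕ.≤-refl
      side≗blocks (suc v) = sym (finToFun-funToFin (side π ∘ suc) v)

    decode : Fin (2 ^ m) → ∃ (F123 (suc m))
    decode x = π , sorts⇒Fishburn π (blocks x) refl sorts , sorts⇒avoids-123 (blocks x) π sorts ∷ []
      where
      π = proj₁ (sorting x)
      sorts : π Sorts key (blocks x)
      sorts = proj₂ (sorting x)

    encode-decode : ∀ x → encode (proj₁ (decode x)) ≡ x
    encode-decode x = trans
      (funToFin-cong (sorts⇒side (proj₁ (decode x)) (blocks x) refl (proj₂ (sorting x)) ∘ suc))
      (funToFin-finToFin {m} {2} x)

    -- Both permutations sort the key of the same block function, so uniqueness of sorting applies.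
    decode-encode : ∀ π → F123 (suc m) π → proj₁ (decode (encode π)) Perm.≈ π
    decode-encode π π∈F = sorts-unique (key (blocks (encode π))) (proj₁ (decode (encode π))) π
      (proj₂ (sorting (encode π))) (sorts-encode π π∈F)

    encode-cong : ∀ π ρ → π Perm.≈ ρ → encode π ≡ encode ρ
    encode-cong π ρ π≈ρ = funToFin-cong (side-cong π ρ π≈ρ ∘ suc)

  F123-cardinality : HasCardinality (F123 (suc m)) (2 ^ m)
  F123-cardinality = record
    { to        = encode ∘ proj₁
    ; from      = decode
    ; to-cong   = λ {π} {ρ} → encode-cong (proj₁ π) (proj₁ ρ)
    ; from-cong = λ { refl _ → refl }
    ; inverse   =
        (λ {x} {π} π≈ → trans (encode-cong (proj₁ π) (proj₁ (decode x)) π≈) (encode-decode x))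
      , (λ { {π} refl → decode-encode (proj₁ π) (proj₂ π) })
    }

-- Equality in `subsetoid` ignores membership proofs, so the congruence and inverse laws carry over
-- unchanged.
HasCardinality-resp-≐ : {P Q : Pred (Permutation′ n) 0ℓ} → P ≐ Q → HasCardinality P N → HasCardinality Q N
HasCardinality-resp-≐ (P⊆Q , Q⊆P) P≅N = record
  { to        = λ (π , π∈Q) → to (π , Q⊆P π∈Q)
  ; from      = λ x → let (π , π∈P) = from x in π , P⊆Q π∈P
  ; to-cong   = to-cong
  ; from-cong = from-cong
  ; inverse   = P≅N.inverseˡ , P≅N.inverseʳ
  }
  where
  module P≅N = Inverse P≅N
  open P≅N using (to; from; to-cong; from-cong)

proposition6p5 : ∀ {k : ℕ} (σ : Permutation′ k) → Unrestrictive σ →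
    (∀ (n : ℕ) → F n ((3 , p123) ∷ (k , σ) ∷ []) ≐ F n ((3 , p123) ∷ [])) ×
    (∀ (n : ℕ) → 1 ≤ n → HasCardinality (F n ((3 , p123) ∷ (k , σ) ∷ [])) (2 ^ (n ∸ 1)))
proposition6p5 {k} σ unrestrictive = F123σ≐F123 , λ where
    (suc m) _ → HasCardinality-resp-≐ (≐-sym (F123σ≐F123 (suc m)))
      (F123-cardinality m)
  where
  F123σ≐F123 : ∀ n → F n ((3 , p123) ∷ (k , σ) ∷ []) ≐ F n ((3 , p123) ∷ [])
  F123σ≐F123 n =
      (λ { (fishburn , avoids ∷ _) → fishburn , avoids ∷ [] })
    , (λ { {π} π∈F@(fishburn , avoids ∷ []) →
           fishburn , avoids ∷ F123⇒avoids-unrestrictive σ unrestrictive π π∈F ∷ [] })
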